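{- Let $k$ and $l$ be non-negative integers. Let $\mathcal{H}$ be a collection of distinct sets $H_1,H_2,\dots,H_m$, all of them included in $[k+l]$. If $m>\binom{k+l}{l}$ then at least one of the following three conditions is true: (1) The $(k+1)$-singleton matrix can be found in the collection of the sets of $\mathcal{H}$ that have at most $l$ elements. (2) The $(l+1)$-cosingleton matrix can be found in the collection of the sets of $\mathcal{H}$ that have at least $l+1$ elements. (3) For some $i\neq j$, $H_j\subset H_i$, $|H_j|\leq l$ and $|H_i|\geq l+1$.
   Context: For a non-negative integer $n$, $[n]=\{1,2,\dots,n\}$ (with $[0]=\emptyset$). A 0-1 matrix $N$ with $a$ rows and $b$ columns can be found in a collection of sets $\mathcal{G}$ if there are distinct sets $G_1,\dots,G_a\in\mathcal{G}$ and distinct elements $e_1,\dots,e_b\in\bigcup_{G\in\mathcal{G}}G$ such that $N_{\alpha,\beta}=1$ if and only if $e_\beta\in G_\alpha$. For an integer $n\ge 1$, the $n$-singleton matrix $S^n$ is the 0-1 matrix with $n+1$ rows and $n$ columns such that $S^n_{i,j}=1$ iff $i=j+1$; the $n$-cosingleton matrix $\bar S^n$ is the 0-1 matrix with $n+1$ rows and $n$ columns such that $\bar S^n_{i,j}=0$ iff $i=j$. -}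

module Defs where

open import Data.Bool.Base using (Bool; true; not)
open import Data.Fin.Base using (Fin; suc; inject₁)
open import Data.Fin.Properties using (_≟_)
open import Data.Fin.Subset using (Subset; _∈_)
open import Data.Nat.Base using (ℕ; suc)
open import Data.Product.Base using (_×_; ∃-syntax)
open import Function.Bundles using (_⇔_)
open import Function.Definitions using (Injective)
open import Level using (0ℓ)
open import Relation.Binary.PropositionalEquality.Core using (_≡_)
open import Relation.Nullary.Decidable.Core using (does)
open import Relation.Unary using (Pred)

-- Throughout, the ground set [n] = {1,…,n} is Fin n, and rows and columns
-- of matrices are likewise numbered from 0; true is 1 and false is 0.

Matrix01 : ℕ → ℕ → Set
Matrix01 a b = Fin a → Fin b → Bool

Collection : ℕ → Set₁
Collection n = Pred (Subset n) 0ℓ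

range : ∀ {m n} → (Fin m → Subset n) → Collection n
range H G = ∃[ i ] H i ≡ G

_∈⋃_ : ∀ {n} → Fin n → Collection n → Set
e ∈⋃ 𝒢 = ∃[ G ] 𝒢 G × e ∈ G

_FoundIn_ : ∀ {a b n} → Matrix01 a b → Collection n → Set
_FoundIn_ {a} {b} {n} N 𝒢 =
  ∃[ G ] ∃[ e ]
    Injective {A = Fin a} {B = Subset n} _≡_ _≡_ G ×
    Injective {A = Fin b} {B = Fin n} _≡_ _≡_ e ×
    (∀ α → 𝒢 (G α)) ×
    (∀ β → e β ∈⋃ 𝒢) ×
    (∀ α β → (N α β ≡ true) ⇔ (e β ∈ G α))

-- Counting from 0 shifts rows and columns alike, so the 1-based conditions
-- i = j + 1 (entry 1) and i = j (entry 0) keep their form; inject₁ only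
-- moves the column index into the type of the row index.
singleton : ∀ n → Matrix01 (suc n) n
singleton n i j = does (i ≟ suc j)

cosingleton : ∀ n → Matrix01 (suc n) n
cosingleton n i j = not (does (i ≟ inject₁ j))

{-# OPTIONS --safe #-}

-- Every H i is sent to an l-subset X i of [k+l]; unless (1), (2) or (3) holds,
-- this map is injective, whence m ≤ (k+l) C l.
--
-- If ∣ H i ∣ ≤ l, let T be a minimal subset of the complement of H i which meets
-- every small H j not contained in H i.  By minimality each x ∈ T is the only
-- point of T in some small H j, so k + 1 points of T yield, with H i as zero row,
-- the singleton matrix.  Otherwise ∣ T ∣ ≤ k, and X i is chosen with
-- H i ⊆ X i ⊆ ∁ T, so that a small H j ⊆ X i is contained in H i.  Large sets are
-- treated dually by complementation: X i ⊆ H i, and a large H j ⊇ X i contains H i.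
-- If X i ≡ X j, then H i ≡ H j when both are small or both large, and the small
-- one lies in the large one otherwise, which is (3).

module Submission where

open import Defs
open import Data.Bool.Base using (true; not)
open import Data.Bool.Properties using (not-¬; ¬-not)
open import Data.Fin.Base using (Fin; zero; suc; inject₁; fromℕ)
open import Data.Fin.Properties using (_≟_; all?; ¬∀⟶∃¬; pigeonhole; sequence; suc-injective; inject₁-injective; fromℕ≢inject₁; <⇒≢)
open import Data.Fin.Relation.Unary.Top using (view; ‵fromℕ; ‵inject₁)
open import Data.Fin.Subset using (Subset; inside; outside; ∁; _∈_; _⊆_; _⊂_; _-_; ∣_∣)
open import Data.Fin.Subset.Induction using (Acc; acc; ⊂-wellFounded)
open import Data.Fin.Subset.Properties
open import Data.List.Base using (List; []; _∷_; [_]; map; _++_; length; lookup)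
open import Data.List.Membership.Propositional using () renaming (_∈_ to _∈ₗ_)
open import Data.List.Membership.Propositional.Properties using (∈-map⁺; ∈-++⁺ˡ; ∈-++⁺ʳ)
open import Data.List.Properties using (length-map; length-++)
open import Data.List.Relation.Unary.Any using (here; index)
open import Data.List.Relation.Unary.Any.Properties using (lookup-index)
open import Data.Nat.Base using (ℕ; zero; suc; _+_; _≤_; _<_; _≥_; _>_; _∸_; z≤n; s≤s; s≤s⁻¹)
open import Data.Nat.Combinatorics using (_C_; nCk+nC[k+1]≡[n+1]C[k+1])
open import Data.Nat.Properties using (_≤?_; ≰⇒>; ≤-trans; +-comm; m≤m+n; m+n∸m≡n; ∸-monoʳ-≤; ≤-antisym; n≮n; module ≤-Reasoning)
open import Data.Product.Base using (_×_; _,_; proj₁; proj₂; ∃-syntax)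
open import Data.Sum.Base using (_⊎_; inj₁; inj₂; map₁)
import Data.Sum.Effectful.Left as Sumₗ
open import Data.Vec.Base using ([]; _∷_; here; there)
open import Function.Base using (_∘_)
open import Function.Bundles using (_⇔_; mk⇔; Equivalence)
open import Function.Definitions using (Injective)
open import Level using (0ℓ)
open import Relation.Binary.PropositionalEquality using (_≡_; _≢_; refl; sym; trans; cong; cong₂; subst; module ≡-Reasoning)
open import Relation.Nullary.Decidable using (yes; no; dec-false; does-⇔; decidable-stable; _→-dec_; ¬?)
open import Relation.Nullary.Negation using (¬_; contradiction)
open import Relation.Unary using (Pred; Decidable)

private
  variable
    n : ℕ
    p q : Subset n

-- Complements, distinct elements and intermediate subsets.

∁-involutive : (p : Subset n) → ∁ (∁ p) ≡ p
∁-involutive p = ⊆-antisym (x∉∁p⇒x∈p ∘ x∈∁p⇒x∉p) (x∉p⇒x∈∁p ∘ x∈p⇒x∉∁p)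

∁-injective : Injective {A = Subset n} _≡_ _≡_ ∁
∁-injective {x = p} {y = q} eq =
  trans (sym (∁-involutive p)) (trans (cong ∁ eq) (∁-involutive q))

p⊆∁q⇒q⊆∁p : p ⊆ ∁ q → q ⊆ ∁ p
p⊆∁q⇒q⊆∁p p⊆∁q x∈q = x∉p⇒x∈∁p λ x∈p → x∈∁p⇒x∉p (p⊆∁q x∈p) x∈q

⊆∧∣∣<⇒⊂ : p ⊆ q → ∣ p ∣ < ∣ q ∣ → p ⊂ q
⊆∧∣∣<⇒⊂ {p = p} {q = q} p⊆q ∣p∣<∣q∣ with p ⊂? q
... | yes p⊂q = p⊂q
... | no  p⊄q = contradiction
  (≤-trans ∣p∣<∣q∣ (p⊆q⇒∣p∣≤∣q∣ λ x∈q → decidable-stable (_ ∈? p) λ x∉p → p⊄q (p⊆q , _ , x∈q , x∉p)))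
  (n≮n _)

elements : (p : Subset n) (c : ℕ) → c ≤ ∣ p ∣ →
  ∃[ e ] Injective {A = Fin c} _≡_ _≡_ e × (∀ i → e i ∈ p)
elements p zero _ = (λ ()) , (λ { {()} }) , λ ()
elements (outside ∷ p) (suc c) c≤ with elements p (suc c) c≤
... | e , e-inj , e∈p = suc ∘ e , e-inj ∘ suc-injective , there ∘ e∈p
elements {suc n} (inside ∷ p) (suc c) c≤ with elements p c (s≤s⁻¹ c≤)
... | e , e-inj , e∈p = e′ , e′-inj , e′∈p
  where
  e′ : Fin (suc c) → Fin (suc n)
  e′ zero    = zero
  e′ (suc i) = suc (e i)

  e′-inj : Injective _≡_ _≡_ e′
  e′-inj {zero}  {zero}  _  = refl
  e′-inj {suc _} {suc _} eq = cong suc (e-inj (suc-injective eq))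

  e′∈p : ∀ i → e′ i ∈ inside ∷ p
  e′∈p zero    = here
  e′∈p (suc i) = there (e∈p i)

-- Elements of `q` outside `p` are left out as long as the rest of `q` is large enough.
interpolate : (p q : Subset n) (l : ℕ) → p ⊆ q → ∣ p ∣ ≤ l → l ≤ ∣ q ∣ →
  ∃[ r ] ∣ r ∣ ≡ l × p ⊆ r × r ⊆ q
interpolate [] [] .zero _ _ z≤n = [] , refl , (λ ()) , λ ()
interpolate (inside ∷ p) (outside ∷ q) l p⊆q _ _ with () ← p⊆q here
interpolate (inside ∷ p) (inside ∷ q) (suc l) p⊆q p≤l l≤q
  with r , r≡l , p⊆r , r⊆q ← interpolate p q l (drop-∷-⊆ p⊆q) (s≤s⁻¹ p≤l) (s≤s⁻¹ l≤q)
  = inside ∷ r , cong suc r≡l , s⊆s p⊆r , s⊆s r⊆q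
interpolate (outside ∷ p) (outside ∷ q) l p⊆q p≤l l≤q
  with r , r≡l , p⊆r , r⊆q ← interpolate p q l (drop-∷-⊆ p⊆q) p≤l l≤q
  = outside ∷ r , r≡l , s⊆s p⊆r , s⊆s r⊆q
interpolate (outside ∷ p) (inside ∷ q) l p⊆q p≤l l≤q with l ≤? ∣ q ∣
... | yes l≤∣q∣
  with r , r≡l , p⊆r , r⊆q ← interpolate p q l (drop-∷-⊆ p⊆q) p≤l l≤∣q∣
  = outside ∷ r , r≡l , s⊆s p⊆r , out⊆ r⊆q
-- Now `inside ∷ q` has exactly `l` elements and is taken whole.
... | no l≰∣q∣ =
  inside ∷ q , ≤-antisym (≰⇒> l≰∣q∣) l≤q , out⊆ (drop-∷-⊆ p⊆q) , λ x∈ → x∈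

-- Subsets of a fixed size, counted by binomial coefficients.

subsetsOfSize : ∀ n → ℕ → List (Subset n)
subsetsOfSize zero    zero    = [ [] ]
subsetsOfSize zero    (suc l) = []
subsetsOfSize (suc n) zero    = map (outside ∷_) (subsetsOfSize n zero)
subsetsOfSize (suc n) (suc l) =
  map (inside ∷_) (subsetsOfSize n l) ++ map (outside ∷_) (subsetsOfSize n (suc l))

length-subsetsOfSize : ∀ n l → length (subsetsOfSize n l) ≡ n C l
length-subsetsOfSize zero    zero    = refl
length-subsetsOfSize zero    (suc l) = refl
length-subsetsOfSize (suc n) zero    = trans (length-map _ (subsetsOfSize n zero)) (length-subsetsOfSize n zero)
length-subsetsOfSize (suc n) (suc l) = begin
  length (map (inside ∷_) ps ++ map (outside ∷_) qs)          ≡⟨ length-++ (map (inside ∷_) ps) ⟩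
  length (map (inside ∷_) ps) + length (map (outside ∷_) qs)  ≡⟨ cong₂ _+_ (length-map _ ps) (length-map _ qs) ⟩
  length ps + length qs                                       ≡⟨ cong₂ _+_ (length-subsetsOfSize n l) (length-subsetsOfSize n (suc l)) ⟩
  n C l + n C suc l                                           ≡⟨ nCk+nC[k+1]≡[n+1]C[k+1] n l ⟩
  suc n C suc l                                               ∎
  where
  open ≡-Reasoning
  ps = subsetsOfSize n l
  qs = subsetsOfSize n (suc l)

∈-subsetsOfSize : ∀ {l} (p : Subset n) → ∣ p ∣ ≡ l → p ∈ₗ subsetsOfSize n l
∈-subsetsOfSize []            refl = here refl
∈-subsetsOfSize (inside ∷ p)  refl = ∈-++⁺ˡ (∈-map⁺ (inside ∷_) (∈-subsetsOfSize p refl))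
∈-subsetsOfSize {l = zero}  (outside ∷ p) eq = ∈-map⁺ (outside ∷_) (∈-subsetsOfSize p eq)
∈-subsetsOfSize {l = suc l} (outside ∷ p) eq =
  ∈-++⁺ʳ (map (inside ∷_) (subsetsOfSize _ l)) (∈-map⁺ (outside ∷_) (∈-subsetsOfSize p eq))

-- The pigeonholes are positions in `subsetsOfSize n l`; looking up a shared position recovers one
-- and the same set.
pigeonhole-subsets : ∀ {m l} (X : Fin m → Subset n) → (∀ i → ∣ X i ∣ ≡ l) →
  n C l < m → ∃[ i ] ∃[ j ] i ≢ j × X i ≡ X j
pigeonhole-subsets {n} {m} {l} X ∣X∣≡l nCl<m
  with i , j , i<j , eq ← pigeonhole (subst (_< m) (sym (length-subsetsOfSize n l)) nCl<m)
                                     (λ i → index (∈-subsetsOfSize (X i) (∣X∣≡l i)))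
  = i , j , <⇒≢ i<j ,
    trans (lookup-index (X∈ i)) (trans (cong (lookup (subsetsOfSize n l)) eq) (sym (lookup-index (X∈ j))))
  where
  X∈ : ∀ i → X i ∈ₗ subsetsOfSize n l
  X∈ i = ∈-subsetsOfSize (X i) (∣X∣≡l i)

-- Minimal separating sets and singleton matrices.

minimal-⊆ : {P : Pred (Subset n) 0ℓ} → Decidable P → (p : Subset n) → P p →
  ∃[ q ] q ⊆ p × P q × (∀ {x} → x ∈ q → ¬ P (q - x))
minimal-⊆ {n} {P} P? p Pp = go p Pp (⊂-wellFounded p)
  where
  go : ∀ p → P p → Acc _⊂_ p → ∃[ q ] q ⊆ p × P q × (∀ {x} → x ∈ q → ¬ P (q - x))
  -- Single elements are deleted while `P` survives, so minimality is with respect to one-element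
  -- deletions.
  go p Pp (acc rec) with all? (λ x → (x ∈? p) →-dec ¬? (P? (p - x)))
  ... | yes minimal = p , (λ x∈p → x∈p) , Pp , minimal _
  ... | no ¬minimal
    with x , ¬x ← ¬∀⟶∃¬ n _ (λ x → (x ∈? p) →-dec ¬? (P? (p - x))) ¬minimal
    with x∈p ← decidable-stable (x ∈? p) (λ x∉p → ¬x λ x∈p → contradiction x∈p x∉p)
    with q , q⊆ , Pq , min ← go (p - x) (decidable-stable (P? (p - x)) λ ¬P → ¬x λ _ → ¬P) (rec (x∈p⇒p-x⊂p x∈p))
    = q , proj₁ (x∈p⇒p-x⊂p x∈p) ∘ q⊆ , Pq , min

-- The last condition on `T` is the contrapositive of meeting every `F j` in `Q` that is not
-- contained in `F i`. The parameters `F` and `Q` let the argument serve both small sets and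
-- complements of large ones.
singleton-or-separator : ∀ {m} (F : Fin m → Subset n) {Q : Pred (Subset n) 0ℓ} → Decidable Q →
  ∀ i → Q (F i) → ∀ c →
  (singleton c FoundIn (λ G → range F G × Q G))
  ⊎ (∃[ T ] T ⊆ ∁ (F i) × ∣ T ∣ < c × (∀ j → Q (F j) → T ⊆ ∁ (F j) → F j ⊆ F i))
singleton-or-separator {n} {m} F {Q} Q? i Qi c
  with T , T⊆∁Fi , separates , minimal ← minimal-⊆ {P = λ T → ∀ j → Q (F j) → T ⊆ ∁ (F j) → F j ⊆ F i}
         (λ T → all? λ j → Q? (F j) →-dec ((T ⊆? ∁ (F j)) →-dec (F j ⊆? F i)))
         -- The descent starts from `∁ (F i)`, which separates because complementation reverses
         -- inclusion.
         (∁ (F i)) (λ j _ → ∁p⊆∁q⇒p⊇q)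
  with c ≤? ∣ T ∣
... | no  c≰∣T∣ = inj₂ (T , T⊆∁Fi , ≰⇒> c≰∣T∣ , separates)
... | yes c≤∣T∣ with e , e-inj , e∈T ← elements T c c≤∣T∣ =
  inj₁ (G , e , G-inj , e-inj , G∈ , (λ β → G (suc β) , G∈ (suc β) , e∈G β) , entries)
  where
  -- Deleting `x` breaks separation at some `j`: `F j` misses `T - x` but is not contained in `F i`.
  -- Since `T` itself separates, `F j` must meet `T`, and can do so only in `x`.
  private-set : ∀ {x} → x ∈ T → ∃[ j ] Q (F j) × x ∈ F j × (∀ {y} → y ∈ T → y ∈ F j → y ≡ x)
  private-set {x} x∈T
    with j , ¬sep ← ¬∀⟶∃¬ m _ (λ j → Q? (F j) →-dec (((T - x) ⊆? ∁ (F j)) →-dec (F j ⊆? F i))) (minimal x∈T)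
    = j , Qj , x∈Fj , only
    where
    Qj : Q (F j)
    Qj = decidable-stable (Q? (F j)) λ ¬Qj → ¬sep λ Qj → contradiction Qj ¬Qj

    T-x⊆∁Fj : T - x ⊆ ∁ (F j)
    T-x⊆∁Fj = decidable-stable ((T - x) ⊆? ∁ (F j)) λ ⊈ → ¬sep λ _ ⊆ → contradiction (λ {y} → ⊆ {y}) ⊈

    only : ∀ {y} → y ∈ T → y ∈ F j → y ≡ x
    only {y} y∈T y∈Fj = decidable-stable (y ≟ x) λ y≢x →
      x∈∁p⇒x∉p (T-x⊆∁Fj (x∈p∧x≢y⇒x∈p-y y∈T y≢x)) y∈Fj

    x∈Fj : x ∈ F j
    x∈Fj = decidable-stable (x ∈? F j) λ x∉Fj → ¬sep λ _ _ → separates j Qj λ y∈T →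
      x∉p⇒x∈∁p λ y∈Fj → x∉Fj (subst (_∈ F j) (only y∈T y∈Fj) y∈Fj)

  G : Fin (suc c) → Subset n
  G zero    = F i
  G (suc β) = F (proj₁ (private-set (e∈T β)))

  G∈ : ∀ α → range F (G α) × Q (G α)
  G∈ zero    = (_ , refl) , Qi
  G∈ (suc β) = (_ , refl) , proj₁ (proj₂ (private-set (e∈T β)))

  e∈G : ∀ β → e β ∈ G (suc β)
  e∈G β = proj₁ (proj₂ (proj₂ (private-set (e∈T β))))

  -- `F i` misses `T`, and a private set meets `T` in one point only. This gives the zero entries,
  -- and also the injectivity of `G`, since equal rows would share their ones.
  e∈G⇒≡ : ∀ α {β} → e β ∈ G α → α ≡ suc β
  e∈G⇒≡ zero    {β} e∈Fi = contradiction e∈Fi (x∈∁p⇒x∉p (T⊆∁Fi (e∈T β)))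
  e∈G⇒≡ (suc α) {β} e∈   =
    cong suc (sym (e-inj (proj₂ (proj₂ (proj₂ (private-set (e∈T α)))) (e∈T β) e∈)))

  G-inj : Injective _≡_ _≡_ G
  G-inj {zero}  {zero}  _  = refl
  G-inj {α}     {suc β} eq = e∈G⇒≡ α (subst (e β ∈_) (sym eq) (e∈G β))
  G-inj {suc β} {α}     eq = sym (e∈G⇒≡ α (subst (e β ∈_) eq (e∈G β)))

  entries : ∀ α β → (singleton c α β ≡ true) ⇔ (e β ∈ G α)
  entries α β with α ≟ suc β
  ... | yes refl = mk⇔ (λ _ → e∈G β) (λ _ → refl)
  ... | no  α≢β  = mk⇔ (λ ()) (λ e∈ → contradiction (e∈G⇒≡ α e∈) α≢β)

-- The zero row of the singleton matrix is its first, the all-one row of the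
-- cosingleton matrix its last.
rotate : Fin (suc n) → Fin (suc n)
rotate α with view α
... | ‵fromℕ     = zero
... | ‵inject₁ i = suc i

rotate-injective : Injective {A = Fin (suc n)} _≡_ _≡_ rotate
rotate-injective {x = α} {y = α′} eq with view α | view α′
... | ‵fromℕ     | ‵fromℕ     = refl
... | ‵inject₁ _ | ‵inject₁ _ = cong inject₁ (suc-injective eq)

cosingleton≡not-singleton : ∀ (α : Fin (suc n)) β → cosingleton n α β ≡ not (singleton n (rotate α) β)
cosingleton≡not-singleton α β with view α
... | ‵fromℕ     = cong not (dec-false (fromℕ _ ≟ inject₁ β) fromℕ≢inject₁)
... | ‵inject₁ i = cong not (does-⇔ (mk⇔ inject₁-injective (cong inject₁)) (inject₁ i ≟ inject₁ β) (i ≟ β))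

-- Complementing the sets flips every entry, and `rotate` puts the rows in the order of the
-- cosingleton matrix.
cosingleton-∁ : ∀ {c} {𝒢 𝒢′ : Collection n} → (∀ {G} → 𝒢 G → 𝒢′ (∁ G)) →
  singleton c FoundIn 𝒢 → cosingleton c FoundIn 𝒢′
cosingleton-∁ {c = c} 𝒢⇒𝒢′ (G , e , G-inj , e-inj , G∈ , _ , entries) =
  ∁ ∘ G ∘ rotate , e , rotate-injective ∘ G-inj ∘ ∁-injective , e-inj , 𝒢⇒𝒢′ ∘ G∈ ∘ rotate ,
  -- The complement of the zero row contains every column element.
  (λ β → ∁ (G zero) , 𝒢⇒𝒢′ (G∈ zero) , x∉p⇒x∈∁p λ e∈ → contradiction (Equivalence.from (entries zero β) e∈) λ ()) ,
  λ α β → mk⇔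
    (λ eq → x∉p⇒x∈∁p λ e∈ → not-¬ refl
      (trans (Equivalence.from (entries (rotate α) β) e∈) (trans (sym eq) (cosingleton≡not-singleton α β))))
    (λ e∈∁ → trans (cosingleton≡not-singleton α β)
      (cong not (¬-not λ eq → x∈∁p⇒x∉p e∈∁ (Equivalence.to (entries (rotate α) β) eq))))

-- Codes of size `l` for small and large sets.

module _ {k l m : ℕ} (H : Fin m → Subset (k + l)) where

  Small Large : Pred (Subset (k + l)) 0ℓ
  Small G = ∣ G ∣ ≤ l
  Large G = ∣ G ∣ ≥ l + 1

  -- The last components let `X` determine `H i`: as the greatest small set of the family inside
  -- `X`, or the least large one containing `X`.
  SmallCode LargeCode : Fin m → Subset (k + l) → Set
  SmallCode i X = Small (H i) × H i ⊆ X × (∀ j → Small (H j) → H j ⊆ X → H j ⊆ H i)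
  LargeCode i X = Large (H i) × X ⊆ H i × (∀ j → Large (H j) → X ⊆ H j → H i ⊆ H j)

  Code : Fin m → Set
  Code i = ∃[ X ] ∣ X ∣ ≡ l × (SmallCode i X ⊎ LargeCode i X)

  ∣∁∣≥ : ∀ T → ∣ T ∣ < k + 1 → l ≤ ∣ ∁ T ∣
  ∣∁∣≥ T ∣T∣<k+1 = begin
    l              ≡⟨ m+n∸m≡n k l ⟨
    k + l ∸ k      ≤⟨ ∸-monoʳ-≤ (k + l) (s≤s⁻¹ (subst (∣ T ∣ <_) (+-comm k 1) ∣T∣<k+1)) ⟩
    k + l ∸ ∣ T ∣  ≡⟨ ∣∁p∣≡n∸∣p∣ T ⟨
    ∣ ∁ T ∣        ∎
    where open ≤-Reasoning

  ∁∁-large : ∀ j → Large (H j) → Large (∁ (∁ (H j)))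
  ∁∁-large j = subst Large (sym (∁-involutive (H j)))

  smallCode : ∀ i → Small (H i) →
    (singleton (k + 1) FoundIn (λ G → range H G × Small G)) ⊎ Code i
  smallCode i small with singleton-or-separator H (λ G → ∣ G ∣ ≤? l) i small (k + 1)
  ... | inj₁ found = inj₁ found
  ... | inj₂ (T , T⊆∁Hi , ∣T∣<k+1 , separates)
    with X , ∣X∣≡l , Hi⊆X , X⊆∁T ← interpolate (H i) (∁ T) l (p⊆∁q⇒q⊆∁p T⊆∁Hi) small (∣∁∣≥ T ∣T∣<k+1)
    = inj₂ (X , ∣X∣≡l , inj₁ (small , Hi⊆X , λ j smallⱼ Hj⊆X →
        separates j smallⱼ (p⊆∁q⇒q⊆∁p (X⊆∁T ∘ Hj⊆X))))

  -- For the complements, `T` lies in `∁ (∁ (H i))`, which is `H i`, and has at most `l` elements,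
  -- so it extends to `X` inside `H i`. A large `H j` containing `X` contains `T`, hence `∁ (H j)`
  -- lies in `∁ (H i)`.
  largeCode : ∀ i → Large (H i) →
    (cosingleton (l + 1) FoundIn (λ G → range H G × Large G)) ⊎ Code i
  largeCode i large
    with singleton-or-separator (∁ ∘ H) (λ G → l + 1 ≤? ∣ ∁ G ∣) i (∁∁-large i large) (l + 1)
  ... | inj₁ found = inj₁ (cosingleton-∁ (λ { ((j , refl) , large) → (j , sym (∁-involutive (H j))) , large }) found)
  ... | inj₂ (T , T⊆∁∁Hi , ∣T∣<l+1 , separates)
    with X , ∣X∣≡l , T⊆X , X⊆Hi ← interpolate T (H i) l (subst (T ⊆_) (∁-involutive (H i)) T⊆∁∁Hi)
           (s≤s⁻¹ (subst (∣ T ∣ <_) (+-comm l 1) ∣T∣<l+1))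
           (≤-trans (m≤m+n l 1) large)
    = inj₂ (X , ∣X∣≡l , inj₂ (large , X⊆Hi , λ j largeⱼ X⊆Hj → ∁p⊆∁q⇒p⊇q
        (separates j (∁∁-large j largeⱼ)
          (subst (T ⊆_) (sym (∁-involutive (H j))) (X⊆Hj ∘ T⊆X)))))

theorem5 : (k l m : ℕ) (H : Fin m → Subset (k + l)) →
    Injective _≡_ _≡_ H →
    m > (k + l) C l →
    (singleton (k + 1) FoundIn (λ G → range H G × ∣ G ∣ ≤ l))
    ⊎ (cosingleton (l + 1) FoundIn (λ G → range H G × ∣ G ∣ ≥ l + 1))
    ⊎ (∃[ i ] ∃[ j ] i ≢ j × H j ⊂ H i × ∣ H j ∣ ≤ l × ∣ H i ∣ ≥ l + 1)
-- Sequencing over the indices yields a matrix if some index does, and otherwise codes for all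
-- indices at once.
theorem5 k l m H H-inj m>C = conclude (sequence (Sumₗ.applicative _ 0ℓ) code)
  where
  Found : Set
  Found = (singleton (k + 1) FoundIn (λ G → range H G × ∣ G ∣ ≤ l))
        ⊎ (cosingleton (l + 1) FoundIn (λ G → range H G × ∣ G ∣ ≥ l + 1))

  Nested : Set
  Nested = ∃[ i ] ∃[ j ] i ≢ j × H j ⊂ H i × ∣ H j ∣ ≤ l × ∣ H i ∣ ≥ l + 1

  code : ∀ i → Found ⊎ Code H i
  code i with ∣ H i ∣ ≤? l
  ... | yes small = map₁ inj₁ (smallCode H i small)
  ... | no ¬small = map₁ inj₂ (largeCode H i (subst (_≤ ∣ H i ∣) (+-comm 1 l) (≰⇒> ¬small)))

  -- The common code gives `H j ⊆ X ⊆ H i`; the sizes make the inclusion strict.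
  nested : ∀ {i j X} → i ≢ j → LargeCode H i X → SmallCode H j X → Nested
  nested {i} i≢j (largeᵢ , X⊆Hi , _) (smallⱼ , Hj⊆X , _) =
    _ , _ , i≢j ,
    ⊆∧∣∣<⇒⊂ (X⊆Hi ∘ Hj⊆X) (≤-trans (s≤s smallⱼ) (subst (_≤ ∣ H i ∣) (+-comm l 1) largeᵢ)) ,
    smallⱼ , largeᵢ

  collision : ∀ {i j X} → i ≢ j →
    SmallCode H i X ⊎ LargeCode H i X → SmallCode H j X ⊎ LargeCode H j X → Nested
  -- For two sets of the same kind, extremality in both directions gives equality, against `H-inj`.
  collision i≢j (inj₁ (smallᵢ , Hi⊆X , maxᵢ)) (inj₁ (smallⱼ , Hj⊆X , maxⱼ)) =
    contradiction (H-inj (⊆-antisym (maxⱼ _ smallᵢ Hi⊆X) (maxᵢ _ smallⱼ Hj⊆X))) i≢j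
  collision i≢j (inj₂ (largeᵢ , X⊆Hi , minᵢ)) (inj₂ (largeⱼ , X⊆Hj , minⱼ)) =
    contradiction (H-inj (⊆-antisym (minᵢ _ largeⱼ X⊆Hj) (minⱼ _ largeᵢ X⊆Hi))) i≢j
  collision i≢j (inj₁ smallᵢ) (inj₂ largeⱼ) = nested (i≢j ∘ sym) largeⱼ smallᵢ
  collision i≢j (inj₂ largeᵢ) (inj₁ smallⱼ) = nested i≢j largeᵢ smallⱼ

  conclude : Found ⊎ (∀ i → Code H i) →
    (singleton (k + 1) FoundIn (λ G → range H G × ∣ G ∣ ≤ l))
    ⊎ (cosingleton (l + 1) FoundIn (λ G → range H G × ∣ G ∣ ≥ l + 1))
    ⊎ Nested
  conclude (inj₁ (inj₁ found)) = inj₁ found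
  conclude (inj₁ (inj₂ found)) = inj₂ (inj₁ found)
  conclude (inj₂ codes)
    with i , j , i≢j , Xi≡Xj ← pigeonhole-subsets (proj₁ ∘ codes) (proj₁ ∘ proj₂ ∘ codes) m>C
    = inj₂ (inj₂ (collision i≢j (proj₂ (proj₂ (codes i)))
        (subst (λ X → SmallCode H j X ⊎ LargeCode H j X) (sym Xi≡Xj) (proj₂ (proj₂ (codes j))))))
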